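{- For every level $t \in \mathcal{L}$ there exist finitely many levels $u_1, \ldots, u_n$, each generated by the grammar $u ::= x \mid 0 \mid s(u) \mid \operatorname{imax}(u, u)$ (with $x \in \mathcal{X}$, i.e. containing no $\max$), such that $t =_{\mathcal{L}} \max(u_1, \ldots, u_n)$.
   Context: $\operatorname{imax}\colon \mathbb{N}\times\mathbb{N}\to\mathbb{N}$ is defined by $\operatorname{imax}(i,0)=0$ and $\operatorname{imax}(i,j+1)=\max(i,j+1)$. Levels are the terms of the grammar $t ::= x \mid 0 \mid s(t) \mid \max(t,t) \mid \operatorname{imax}(t,t)$, where $x$ ranges over a countable set of variables $\mathcal{X}$; $\mathcal{L}$ denotes the set of levels. A valuation is a function $\sigma\colon\mathcal{X}\to\mathbb{N}$; the value $[t]_\sigma$ is defined by $[0]_\sigma=0$, $[x]_\sigma=\sigma(x)$, $[s(t)]_\sigma=[t]_\sigma+1$, $[\max(t_1,t_2)]_\sigma=\max([t_1]_\sigma,[t_2]_\sigma)$, $[\operatorname{imax}(t_1,t_2)]_\sigma=\operatorname{imax}([t_1]_\sigma,[t_2]_\sigma)$. $t_1 =_{\mathcal{L}} t_2$ means $[t_1]_\sigma=[t_2]_\sigma$ for every valuation $\sigma$. $\max(u_1,\ldots,u_n)$ denotes the $n$-ary maximum (its value is the maximum of the values). -}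

module Defs where

open import Data.Nat.Base using (ℕ; zero; suc; _⊔_)
open import Data.List.NonEmpty.Base using (List⁺; foldr₁)
open import Relation.Binary.PropositionalEquality using (_≡_)

imaxℕ : ℕ → ℕ → ℕ
imaxℕ i zero    = zero
imaxℕ i (suc j) = i ⊔ suc j

data Level (X : Set) : Set where
  var  : X → Level X
  O    : Level X
  s    : Level X → Level X
  max  : Level X → Level X → Level X
  imax : Level X → Level X → Level X

Valuation : Set → Set
Valuation X = X → ℕ

⟦_⟧ : {X : Set} → Level X → Valuation X → ℕ
⟦ var x ⟧    σ = σ x
⟦ O ⟧        σ = 0
⟦ s t ⟧      σ = suc (⟦ t ⟧ σ)
⟦ max t u ⟧  σ = ⟦ t ⟧ σ ⊔ ⟦ u ⟧ σ
⟦ imax t u ⟧ σ = imaxℕ (⟦ t ⟧ σ) (⟦ u ⟧ σ)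

infix 4 _=ᴸ_

_=ᴸ_ : {X : Set} → Level X → Level X → Set
_=ᴸ_ {X} t u = (σ : Valuation X) → ⟦ t ⟧ σ ≡ ⟦ u ⟧ σ

-- The n-ary maximum, n ≥ 1, as an iterated binary one: max(u₁, max(u₂, … uₙ)),
-- and just u₁ when n = 1.
max⁺ : {X : Set} → List⁺ (Level X) → Level X
max⁺ = foldr₁ max

data MaxFree {X : Set} : Level X → Set where
  var  : (x : X) → MaxFree (var x)
  O    : MaxFree O
  s    : {u : Level X} → MaxFree u → MaxFree (s u)
  imax : {u v : Level X} → MaxFree u → MaxFree v → MaxFree (imax u v)

{-# OPTIONS --safe #-}
-- Successor and imax both distribute over max, imax in each of its arguments
-- separately, so every max can be pulled to the top of the term.
module Submission where

open import Defs
open import Data.Nat.Base using (ℕ; zero; suc; _⊔_)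
open import Algebra.Properties.CommutativeSemigroup using (interchange)
open import Data.Nat.Properties using (⊔-assoc; ⊔-commutativeSemigroup; ⊔-idem; ⊔-identityʳ)
open import Data.List.Base using ([]; _∷_)
import Data.List.Relation.Unary.All as List using (All; []; _∷_)
open import Data.List.Relation.Unary.All.Properties using (++⁺)
open import Data.Product.Base using (Σ-syntax; _×_; _,_)
open import Data.List.NonEmpty.Base using (List⁺; _∷_; _⁺++⁺_)
open import Data.List.NonEmpty.Relation.Unary.All using (All; _∷_)
open import Function.Bundles using (_↣_)
open import Relation.Binary.PropositionalEquality using (_≡_; refl; sym; trans; cong; cong₂)

-- Induction on `t`: the levels equal to a finite maximum of max-free ones contain the variables and
-- `O` and are closed under every constructor. For `max`, concatenate the two lists. For `s` and
-- `imax`, distributivity over `max` moves the constructor onto the list entries; two maxima under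
-- `imax` thus give one `imax` for each pair of entries.

imaxℕ-distribˡ-⊔ : ∀ i j k → imaxℕ i (j ⊔ k) ≡ imaxℕ i j ⊔ imaxℕ i k
imaxℕ-distribˡ-⊔ i zero    k       = refl
imaxℕ-distribˡ-⊔ i (suc j) zero    = sym (⊔-identityʳ _)
-- With both arguments positive, `i` occurs once on the left and twice on the right; idempotence
-- supplies the second copy.
imaxℕ-distribˡ-⊔ i (suc j) (suc k) =
  trans (cong (_⊔ suc (j ⊔ k)) (sym (⊔-idem i)))
        (interchange ⊔-commutativeSemigroup i i (suc j) (suc k))

-- Only `k` decides whether `imaxℕ` collapses to zero, so it does so on both sides at once;
-- otherwise both are plain maxima, up to repeating `suc k`.
imaxℕ-distribʳ-⊔ : ∀ k i j → imaxℕ (i ⊔ j) k ≡ imaxℕ i k ⊔ imaxℕ j k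
imaxℕ-distribʳ-⊔ zero    i j = refl
imaxℕ-distribʳ-⊔ (suc k) i j =
  trans (cong ((i ⊔ j) ⊔_) (sym (⊔-idem (suc k))))
        (interchange ⊔-commutativeSemigroup i j (suc k) (suc k))

module _ {X : Set} where

  MaxOfMaxFree : Level X → Set
  MaxOfMaxFree t = Σ[ us ∈ List⁺ (Level X) ] (All MaxFree us × t =ᴸ max⁺ us)

  maxFree : ∀ {u} → MaxFree u → MaxOfMaxFree u
  maxFree {u} p = (u ∷ []) , (p ∷ List.[]) , λ _ → refl

  resp-=ᴸ : ∀ t u → t =ᴸ u → MaxOfMaxFree u → MaxOfMaxFree t
  resp-=ᴸ _ _ t=u (us , ps , u=us) = us , ps , λ σ → trans (t=u σ) (u=us σ)

  max⁺-++ : ∀ u us (vs : List⁺ (Level X)) →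
    max⁺ ((u ∷ us) ⁺++⁺ vs) =ᴸ max (max⁺ (u ∷ us)) (max⁺ vs)
  max⁺-++ u []        vs σ = refl
  max⁺-++ u (u′ ∷ us) vs σ =
    trans (cong (⟦ u ⟧ σ ⊔_) (max⁺-++ u′ us vs σ))
          (sym (⊔-assoc (⟦ u ⟧ σ) _ _))

  max-closed : ∀ t u → MaxOfMaxFree t → MaxOfMaxFree u → MaxOfMaxFree (max t u)
  max-closed _ _ (u ∷ us , p ∷ ps , t=us) (vs , q ∷ qs , u=vs) =
    (u ∷ us) ⁺++⁺ vs , p ∷ ++⁺ ps (q List.∷ qs) ,
    λ σ → trans (cong₂ _⊔_ (t=us σ) (u=vs σ)) (sym (max⁺-++ u us vs σ))

  -- By induction on the list, `f` is pushed through the iterated `max` to the entries. Its value at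
  -- a max-free level need only be a maximum of max-free levels, so that uses can be nested.
  distributive-closed : (f : Level X → Level X) →
    (∀ t u → t =ᴸ u → f t =ᴸ f u) →
    (∀ t u → f (max t u) =ᴸ max (f t) (f u)) →
    (∀ {u} → MaxFree u → MaxOfMaxFree (f u)) →
    ∀ t → MaxOfMaxFree t → MaxOfMaxFree (f t)
  distributive-closed f f-cong f-max f-maxFree t (u ∷ us , p ∷ ps , t=us) =
    resp-=ᴸ (f t) (f (max⁺ (u ∷ us))) (f-cong t _ t=us) (go p ps)
    where
    go : ∀ {u us} → MaxFree u → List.All MaxFree us → MaxOfMaxFree (f (max⁺ (u ∷ us)))
    go p List.[] = f-maxFree p
    go {u} {u′ ∷ us} p (p′ List.∷ ps) =
      resp-=ᴸ (f (max u v)) (max (f u) (f v)) (f-max u v)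
        (max-closed (f u) (f v) (f-maxFree p) (go p′ ps))
      where v = max⁺ (u′ ∷ us)

  s-closed : ∀ t → MaxOfMaxFree t → MaxOfMaxFree (s t)
  s-closed = distributive-closed s (λ _ _ t=u σ → cong suc (t=u σ)) (λ _ _ _ → refl)
    (λ p → maxFree (s p))

  imax-closed : ∀ t u → MaxOfMaxFree t → MaxOfMaxFree u → MaxOfMaxFree (imax t u)
  imax-closed t u T U = distributive-closed (λ t → imax t u)
    (λ _ _ t=t′ σ → cong (λ i → imaxℕ i (⟦ u ⟧ σ)) (t=t′ σ))
    (λ t t′ σ → imaxℕ-distribʳ-⊔ (⟦ u ⟧ σ) (⟦ t ⟧ σ) (⟦ t′ ⟧ σ))
    -- Here the first argument is already max-free, but `u` is not: a second expansion, now in `u`,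
    -- finishes the job.
    (λ {t} p → distributive-closed (imax t)
      (λ _ _ u=u′ σ → cong (imaxℕ (⟦ t ⟧ σ)) (u=u′ σ))
      (λ u u′ σ → imaxℕ-distribˡ-⊔ (⟦ t ⟧ σ) (⟦ u ⟧ σ) (⟦ u′ ⟧ σ))
      (λ q → maxFree (imax p q)) u U)
    t T

  maxOfMaxFree : ∀ t → MaxOfMaxFree t
  maxOfMaxFree (var x)    = maxFree (var x)
  maxOfMaxFree O          = maxFree O
  maxOfMaxFree (s t)      = s-closed t (maxOfMaxFree t)
  maxOfMaxFree (max t u)  = max-closed t u (maxOfMaxFree t) (maxOfMaxFree u)
  maxOfMaxFree (imax t u) = imax-closed t u (maxOfMaxFree t) (maxOfMaxFree u)

theorem13 : (X : Set) → X ↣ ℕ → (t : Level X) →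
    Σ[ us ∈ List⁺ (Level X) ] (All MaxFree us × t =ᴸ max⁺ us)
theorem13 X _ = maxOfMaxFree
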